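{- Let $m\in\mathbb Z$ and let $\mathcal U_m$ be the affine scheme over $\mathbb Z$ defined by $x^2+y^2+z^2-xyz=m$. Suppose $\mathcal U_m(A_{\mathbb Z})\neq\emptyset$, where $\mathcal U_m(A_{\mathbb Z})=\mathcal U_m(\mathbb R)\times\prod_{p \text{ prime}}\mathcal U_m(\mathbb Z_p)$. Then for any finite set $S$ of primes, the image of the natural (diagonal) map $\mathcal U_m(\mathbb Z)\to\prod_{p\notin S}\mathcal U_m(\mathbb Z_p)$ is not dense (for the product of the $p$-adic topologies). -}

module Defs where

open import Algebra.Bundles using (CommutativeRing)
open import Algebra.Morphism.Structures using (module RingMorphisms)
open import Data.Integer.Base as ℤ using (ℤ; +_; -[1+_]; 0ℤ; 1ℤ)
import Data.Integer.Properties as ℤ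
open import Data.Integer.Divisibility.Signed
  using (_∣_; divides; ∣m∣n⇒∣m+n; ∣m⇒∣-m; ∣n⇒∣m*n; ∣m⇒∣m*n)
import Data.Integer.Solver as ℤ
open import Data.List.Base using (List)
open import Data.List.Membership.Propositional using (_∈_; _∉_)
open import Data.Nat.Base as ℕ using (ℕ; zero; suc)
import Data.Nat.Properties as ℕ
open import Data.Nat.Primality using (Prime)
open import Data.Product using (∃; ∃-syntax; _×_; _,_)
open import Data.Rational.Base as ℚ using (ℚ; 0ℚ; 1ℚ; ½; ∣_∣)
import Data.Rational.Properties as ℚ
import Data.Rational.Solver as ℚ
open import Data.Refinement.Base using (Refinement-syntax; value)
open import Level using (0ℓ; _⊔_)
open import Relation.Binary.PropositionalEquality
  using (_≡_; refl; sym; trans; cong; subst)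
open import Relation.Unary using (Pred)

module _ {c ℓ} (R : CommutativeRing c ℓ) where
  open CommutativeRing R
  open import Algebra.Definitions.RawMonoid +-rawMonoid
    using () renaming (_×_ to _·_)

  fromℤ : ℤ → Carrier
  fromℤ (+ n)    = n · 1#
  fromℤ -[1+ n ] = - (suc n · 1#)

-- The scheme is given by its functor of points on commutative rings, with
-- m mapped into R by the unique ring homomorphism from ℤ.
record 𝒰 {c ℓ} (m : ℤ) (R : CommutativeRing c ℓ) : Set (c ⊔ ℓ) where
  constructor point
  open CommutativeRing R hiding (zero)
  field
    x y z    : Carrier
    equation : x * x + y * y + z * z + - (x * y * z) ≈ fromℤ R m

module _ {c₁ ℓ₁ c₂ ℓ₂} (R : CommutativeRing c₁ ℓ₁) (T : CommutativeRing c₂ ℓ₂) where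
  private
    module R = CommutativeRing R
    module T = CommutativeRing T
  open RingMorphisms R.rawRing T.rawRing using (IsRingHomomorphism)
  open import Relation.Binary.Reasoning.Setoid T.setoid
  open import Algebra.Definitions.RawMonoid R.+-rawMonoid
    using () renaming (_×_ to _·ᴿ_)
  open import Algebra.Definitions.RawMonoid T.+-rawMonoid
    using () renaming (_×_ to _·ᵀ_)

  module _ {f : R.Carrier → T.Carrier} (f-hom : IsRingHomomorphism f) where
    open IsRingHomomorphism f-hom

    private
      natural : ∀ n → f (n ·ᴿ R.1#) T.≈ n ·ᵀ T.1#
      natural zero    = 0#-homo
      natural (suc n) = T.trans (+-homo _ _) (T.+-cong 1#-homo (natural n))

    fromℤ-homo : ∀ m → f (fromℤ R m) T.≈ fromℤ T m
    fromℤ-homo (+ n)    = natural n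
    fromℤ-homo -[1+ n ] = T.trans (-‿homo _) (T.-‿cong (natural (suc n)))

    𝒰-map : ∀ {m} → 𝒰 m R → 𝒰 m T
    𝒰-map {m} (point x y z eq) = point (f x) (f y) (f z) (begin
      f x T.* f x T.+ f y T.* f y T.+ f z T.* f z T.+ T.- (f x T.* f y T.* f z)
        ≈⟨ T.+-cong (T.+-cong (T.+-cong (*-homo _ _) (*-homo _ _)) (*-homo _ _))
                    (T.-‿cong (T.trans (*-homo _ _) (T.*-cong (*-homo _ _) T.refl))) ⟨
      f (x R.* x) T.+ f (y R.* y) T.+ f (z R.* z) T.+ T.- f (x R.* y R.* z)
        ≈⟨ T.+-cong (T.trans (+-homo _ _) (T.+-cong (+-homo _ _) T.refl)) (-‿homo _) ⟨
      f (x R.* x R.+ y R.* y R.+ z R.* z) T.+ f (R.- (x R.* y R.* z))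
        ≈⟨ +-homo _ _ ⟨
      f (x R.* x R.+ y R.* y R.+ z R.* z R.+ R.- (x R.* y R.* z))
        ≈⟨ ⟦⟧-cong eq ⟩
      f (fromℤ R m)
        ≈⟨ fromℤ-homo m ⟩
      fromℤ T m ∎)

ℤ-ring : CommutativeRing 0ℓ 0ℓ
ℤ-ring = ℤ.+-*-commutativeRing

-- The p-adic integers, as the inverse limit of the rings ℤ/pⁿ.  An
-- element is given by integers representing its residues, so equality
-- is the setoid equality below.

record ℤ[_] (p : ℕ) : Set where
  constructor adic
  field
    residue  : ℕ → ℤ
    coherent : ∀ n → + (p ℕ.^ n) ∣ residue (suc n) ℤ.- residue n

open ℤ[_] public

module _ {p : ℕ} where

  infix 4 _≡_mod^_ _≈ₚ_

  _≡_mod^_ : ℤ[ p ] → ℤ[ p ] → ℕ → Set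
  a ≡ b mod^ n = + (p ℕ.^ n) ∣ residue a n ℤ.- residue b n

  _≈ₚ_ : ℤ[ p ] → ℤ[ p ] → Set
  a ≈ₚ b = ∀ n → a ≡ b mod^ n

module _ where
  open ℤ.+-*-Solver

  private
    variable
      a b d : ℤ

    diff-self : ∀ a → d ∣ a ℤ.- a
    diff-self a = divides 0ℤ (ℤ.+-inverseʳ a)

    diff-refl : a ≡ b → d ∣ a ℤ.- b
    diff-refl {a} refl = diff-self a

    diff-sym : ∀ a b → d ∣ a ℤ.- b → d ∣ b ℤ.- a
    diff-sym a b h = subst (_ ∣_)
      (solve 2 (λ a b → :- (a :- b) := b :- a) refl a b) (∣m⇒∣-m h)

    diff-trans : ∀ a b c → d ∣ a ℤ.- b → d ∣ b ℤ.- c → d ∣ a ℤ.- c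
    diff-trans a b c h k = subst (_ ∣_)
      (solve 3 (λ a b c → (a :- b) :+ (b :- c) := a :- c) refl a b c)
      (∣m∣n⇒∣m+n h k)

    diff-+ : ∀ a a′ b b′ → d ∣ a ℤ.- a′ → d ∣ b ℤ.- b′ →
             d ∣ (a ℤ.+ b) ℤ.- (a′ ℤ.+ b′)
    diff-+ a a′ b b′ h k = subst (_ ∣_)
      (solve 4 (λ a a′ b b′ →
         (a :- a′) :+ (b :- b′) := (a :+ b) :- (a′ :+ b′)) refl a a′ b b′)
      (∣m∣n⇒∣m+n h k)

    diff-* : ∀ a a′ b b′ → d ∣ a ℤ.- a′ → d ∣ b ℤ.- b′ →
             d ∣ (a ℤ.* b) ℤ.- (a′ ℤ.* b′)
    diff-* a a′ b b′ h k = subst (_ ∣_)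
      (solve 4 (λ a a′ b b′ →
         (a :- a′) :* b :+ a′ :* (b :- b′) := a :* b :- a′ :* b′) refl a a′ b b′)
      (∣m∣n⇒∣m+n (∣m⇒∣m*n b h) (∣n⇒∣m*n a′ k))

    diff-neg : ∀ a a′ → d ∣ a ℤ.- a′ → d ∣ (ℤ.- a) ℤ.- (ℤ.- a′)
    diff-neg a a′ h = subst (_ ∣_)
      (solve 2 (λ a a′ → :- (a :- a′) := (:- a) :- (:- a′)) refl a a′) (∣m⇒∣-m h)

  ℤ-adic : ℕ → CommutativeRing 0ℓ 0ℓ
  ℤ-adic p = record
    { Carrier = ℤ[ p ]
    ; _≈_     = _≈ₚ_
    ; _+_     = λ a b → adic (λ n → residue a n ℤ.+ residue b n)
                  λ n → diff-+ (residue a (suc n)) _ (residue b (suc n)) _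
                               (coherent a n) (coherent b n)
    ; _*_     = λ a b → adic (λ n → residue a n ℤ.* residue b n)
                  λ n → diff-* (residue a (suc n)) _ (residue b (suc n)) _
                               (coherent a n) (coherent b n)
    ; -_      = λ a → adic (λ n → ℤ.- residue a n)
                  λ n → diff-neg (residue a (suc n)) _ (coherent a n)
    ; 0#      = adic (λ _ → 0ℤ) (λ _ → diff-self 0ℤ)
    ; 1#      = adic (λ _ → 1ℤ) (λ _ → diff-self 1ℤ)
    ; isCommutativeRing = record
      { isRing = record
        { +-isAbelianGroup = record
          { isGroup = record
            { isMonoid = record
              { isSemigroup = record
                { isMagma = record
                  { isEquivalence = record
                    { refl  = λ {a} n → diff-self (residue a n)
                    ; sym   = λ {a} {b} h n → diff-sym (residue a n) _ (h n)
                    ; trans = λ {a} {b} {c} h k n →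
                        diff-trans (residue a n) (residue b n) _ (h n) (k n)
                    }
                  ; ∙-cong = λ {a} {a′} {b} {b′} h k n →
                      diff-+ (residue a n) _ (residue b n) _ (h n) (k n)
                  }
                ; assoc = λ a b c n →
                    diff-refl (ℤ.+-assoc (residue a n) (residue b n) (residue c n))
                }
              ; identity = (λ a n → diff-refl (ℤ.+-identityˡ (residue a n)))
                         , (λ a n → diff-refl (ℤ.+-identityʳ (residue a n)))
              }
            ; inverse = (λ a n → diff-refl (ℤ.+-inverseˡ (residue a n)))
                      , (λ a n → diff-refl (ℤ.+-inverseʳ (residue a n)))
            ; ⁻¹-cong = λ {a} {b} h n → diff-neg (residue a n) _ (h n)
            }
          ; comm = λ a b n → diff-refl (ℤ.+-comm (residue a n) (residue b n))
          }
        ; *-cong = λ {a} {a′} {b} {b′} h k n →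
            diff-* (residue a n) _ (residue b n) _ (h n) (k n)
        ; *-assoc = λ a b c n →
            diff-refl (ℤ.*-assoc (residue a n) (residue b n) (residue c n))
        ; *-identity = (λ a n → diff-refl (ℤ.*-identityˡ (residue a n)))
                     , (λ a n → diff-refl (ℤ.*-identityʳ (residue a n)))
        ; distrib = (λ a b c n → diff-refl
                       (ℤ.*-distribˡ-+ (residue a n) (residue b n) (residue c n)))
                  , (λ a b c n → diff-refl
                       (ℤ.*-distribʳ-+ (residue a n) (residue b n) (residue c n)))
        }
      ; *-comm = λ a b n → diff-refl (ℤ.*-comm (residue a n) (residue b n))
      }
    }

  ℤ→ℤ-adic : ∀ p → ℤ → ℤ[ p ]
  ℤ→ℤ-adic p a = adic (λ _ → a) (λ _ → diff-self a)

  ℤ→ℤ-adic-isRingHomomorphism : ∀ p →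
    RingMorphisms.IsRingHomomorphism
      (CommutativeRing.rawRing ℤ-ring) (CommutativeRing.rawRing (ℤ-adic p))
      (ℤ→ℤ-adic p)
  ℤ→ℤ-adic-isRingHomomorphism p = record
    { isSemiringHomomorphism = record
      { isNearSemiringHomomorphism = record
        { +-isMonoidHomomorphism = record
          { isMagmaHomomorphism = record
            { isRelHomomorphism = record { cong = λ eq n → diff-refl eq }
            ; homo = λ a b n → diff-self (a ℤ.+ b)
            }
          ; ε-homo = λ n → diff-self 0ℤ
          }
        ; *-homo = λ a b n → diff-self (a ℤ.* b)
        }
      ; 1#-homo = λ n → diff-self 1ℤ
      }
    ; -‿homo = λ a n → diff-self (ℤ.- a)
    }

-- The reals are Cauchy sequences of rationals; the equality below
-- identifies sequences whose difference is null.

record ℝ : Set where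
  constructor real
  field
    approx : ℕ → ℚ
    cauchy : ∀ ε → 0ℚ ℚ.< ε → ∃[ N ] ∀ i j → N ℕ.≤ i → N ℕ.≤ j →
             ∣ approx i ℚ.- approx j ∣ ℚ.< ε

open ℝ public

infix 4 _≈ᵣ_

_≈ᵣ_ : ℝ → ℝ → Set
a ≈ᵣ b = ∀ ε → 0ℚ ℚ.< ε → ∃[ N ] ∀ i → N ℕ.≤ i →
         ∣ approx a i ℚ.- approx b i ∣ ℚ.< ε

module _ where
  open ℚ.+-*-Solver
  open ℚ.≤-Reasoning

  private
    half : ∀ {ε} → 0ℚ ℚ.< ε → 0ℚ ℚ.< ½ ℚ.* ε
    half {ε} 0<ε = subst (ℚ._< ½ ℚ.* ε) (ℚ.*-zeroʳ ½) (ℚ.*-monoʳ-<-pos ½ 0<ε)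

    halves : ∀ ε → ½ ℚ.* ε ℚ.+ ½ ℚ.* ε ≡ ε
    halves ε = trans (sym (ℚ.*-distribʳ-+ ε ½ ½)) (ℚ.*-identityˡ ε)

    shrink : ∀ B ε → 0ℚ ℚ.< B → 0ℚ ℚ.< ε → ∃[ δ ] 0ℚ ℚ.< δ × δ ℚ.* B ≡ ε
    shrink B ε 0<B 0<ε = δ , ℚ.positive⁻¹ δ , δB≡ε
      where
      instance
        B-pos = ℚ.positive 0<B
        ε-pos = ℚ.positive 0<ε
        B-nonZero = ℚ.pos⇒nonZero B
        1/B-pos = ℚ.1/pos⇒pos B
      δ = ε ℚ.* ℚ.1/ B
      instance
        δ-pos = ℚ.pos*pos⇒pos ε (ℚ.1/ B)
      δB≡ε : δ ℚ.* B ≡ ε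
      δB≡ε = trans (ℚ.*-assoc ε (ℚ.1/ B) B)
               (trans (cong (ε ℚ.*_) (ℚ.*-inverseˡ B)) (ℚ.*-identityʳ ε))

    dist-self : ∀ a {ε} → 0ℚ ℚ.< ε → ∣ a ℚ.- a ∣ ℚ.< ε
    dist-self a 0<ε rewrite ℚ.+-inverseʳ a = 0<ε

    dist-sym : ∀ a b → ∣ a ℚ.- b ∣ ≡ ∣ b ℚ.- a ∣
    dist-sym a b = trans (sym (ℚ.∣-p∣≡∣p∣ (a ℚ.- b)))
      (cong ∣_∣ (solve 2 (λ a b → :- (a :- b) := b :- a) refl a b))

    sum< : ∀ u v {ε} → ∣ u ∣ ℚ.< ½ ℚ.* ε → ∣ v ∣ ℚ.< ½ ℚ.* ε → ∣ u ℚ.+ v ∣ ℚ.< ε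
    sum< u v {ε} hu hv = begin-strict
      ∣ u ℚ.+ v ∣         ≤⟨ ℚ.∣p+q∣≤∣p∣+∣q∣ u v ⟩
      ∣ u ∣ ℚ.+ ∣ v ∣     <⟨ ℚ.+-mono-< hu hv ⟩
      ½ ℚ.* ε ℚ.+ ½ ℚ.* ε ≡⟨ halves ε ⟩
      ε                   ∎

    dist-trans : ∀ a b c {ε} → ∣ a ℚ.- b ∣ ℚ.< ½ ℚ.* ε → ∣ b ℚ.- c ∣ ℚ.< ½ ℚ.* ε →
                 ∣ a ℚ.- c ∣ ℚ.< ε
    dist-trans a b c {ε} h k = subst (λ t → ∣ t ∣ ℚ.< ε)
      (solve 3 (λ a b c → (a :- b) :+ (b :- c) := a :- c) refl a b c)
      (sum< (a ℚ.- b) (b ℚ.- c) h k)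

    dist-+ : ∀ a a′ b b′ {ε} → ∣ a ℚ.- a′ ∣ ℚ.< ½ ℚ.* ε → ∣ b ℚ.- b′ ∣ ℚ.< ½ ℚ.* ε →
             ∣ (a ℚ.+ b) ℚ.- (a′ ℚ.+ b′) ∣ ℚ.< ε
    dist-+ a a′ b b′ {ε} h k = subst (λ t → ∣ t ∣ ℚ.< ε)
      (solve 4 (λ a a′ b b′ →
         (a :- a′) :+ (b :- b′) := (a :+ b) :- (a′ :+ b′)) refl a a′ b b′)
      (sum< (a ℚ.- a′) (b ℚ.- b′) h k)

    dist-neg : ∀ a a′ → ∣ a ℚ.- a′ ∣ ≡ ∣ (ℚ.- a) ℚ.- (ℚ.- a′) ∣
    dist-neg a a′ = trans (sym (ℚ.∣-p∣≡∣p∣ (a ℚ.- a′)))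
      (cong ∣_∣ (solve 2 (λ a a′ → :- (a :- a′) := (:- a) :- (:- a′)) refl a a′))

    small* : ∀ u b {δ B} → 0ℚ ℚ.< B → ∣ u ∣ ℚ.< δ → ∣ b ∣ ℚ.< B → ∣ u ℚ.* b ∣ ℚ.< δ ℚ.* B
    small* u b {δ} {B} 0<B hu hb = begin-strict
      ∣ u ℚ.* b ∣     ≡⟨ ℚ.∣p*q∣≡∣p∣*∣q∣ u b ⟩
      ∣ u ∣ ℚ.* ∣ b ∣ ≤⟨ ℚ.*-monoˡ-≤-nonNeg ∣ u ∣ {{ℚ.∣-∣-nonNeg u}} (ℚ.<⇒≤ hb) ⟩
      ∣ u ∣ ℚ.* B     <⟨ ℚ.*-monoˡ-<-pos B {{ℚ.positive 0<B}} hu ⟩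
      δ ℚ.* B         ∎

    dist-* : ∀ a a′ b b′ {ε δ₁ δ₂ A B} → 0ℚ ℚ.< A → 0ℚ ℚ.< B →
             δ₁ ℚ.* B ≡ ½ ℚ.* ε → δ₂ ℚ.* A ≡ ½ ℚ.* ε →
             ∣ a′ ∣ ℚ.< A → ∣ b ∣ ℚ.< B →
             ∣ a ℚ.- a′ ∣ ℚ.< δ₁ → ∣ b ℚ.- b′ ∣ ℚ.< δ₂ →
             ∣ (a ℚ.* b) ℚ.- (a′ ℚ.* b′) ∣ ℚ.< ε
    dist-* a a′ b b′ {ε} 0<A 0<B eq₁ eq₂ ha′ hb h k = subst (λ t → ∣ t ∣ ℚ.< ε)
      (solve 4 (λ a a′ b b′ →
         (a :- a′) :* b :+ (b :- b′) :* a′ := a :* b :- a′ :* b′) refl a a′ b b′)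
      (sum< ((a ℚ.- a′) ℚ.* b) ((b ℚ.- b′) ℚ.* a′)
        (subst (∣ (a ℚ.- a′) ℚ.* b ∣ ℚ.<_) eq₁ (small* (a ℚ.- a′) b 0<B h hb))
        (subst (∣ (b ℚ.- b′) ℚ.* a′ ∣ ℚ.<_) eq₂ (small* (b ℚ.- b′) a′ 0<A k ha′)))

    bounded : ∀ a → ∃[ B ] 0ℚ ℚ.< B × ∃[ N ] ∀ i → N ℕ.≤ i → ∣ approx a i ∣ ℚ.< B
    bounded a with cauchy a 1ℚ (ℚ.positive⁻¹ 1ℚ)
    ... | N , close = 1ℚ ℚ.+ ∣ aN ∣
        , ℚ.+-mono-<-≤ (ℚ.positive⁻¹ 1ℚ) (ℚ.0≤∣p∣ aN)
        , N , λ i N≤i → begin-strict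
            ∣ approx a i ∣
              ≡⟨ cong ∣_∣ (solve 2 (λ x y → x := (x :- y) :+ y) refl (approx a i) aN) ⟩
            ∣ approx a i ℚ.- aN ℚ.+ aN ∣
              ≤⟨ ℚ.∣p+q∣≤∣p∣+∣q∣ (approx a i ℚ.- aN) aN ⟩
            ∣ approx a i ℚ.- aN ∣ ℚ.+ ∣ aN ∣
              <⟨ ℚ.+-monoˡ-< ∣ aN ∣ (close i N N≤i ℕ.≤-refl) ⟩
            1ℚ ℚ.+ ∣ aN ∣ ∎
      where aN = approx a N

    ⊔ˡ : ∀ {M N i} → M ℕ.⊔ N ℕ.≤ i → M ℕ.≤ i
    ⊔ˡ = ℕ.≤-trans (ℕ.m≤m⊔n _ _)

    ⊔ʳ : ∀ {M N i} → M ℕ.⊔ N ℕ.≤ i → N ℕ.≤ i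
    ⊔ʳ {M} = ℕ.≤-trans (ℕ.m≤n⊔m M _)

    ≡⇒≈ᵣ : ∀ {a b} → (∀ i → approx a i ≡ approx b i) → a ≈ᵣ b
    ≡⇒≈ᵣ {a} eq ε 0<ε = 0 , λ i _ →
      subst (λ t → ∣ approx a i ℚ.- t ∣ ℚ.< ε) (eq i) (dist-self (approx a i) 0<ε)

    const : ℚ → ℝ
    const q = real (λ _ → q) λ ε 0<ε → 0 , λ _ _ _ _ → dist-self q 0<ε

    infixl 6 _+_
    infixl 7 _*_

    _+_ : ℝ → ℝ → ℝ
    a + b = real (λ i → approx a i ℚ.+ approx b i) λ ε 0<ε →
      let (M , h) = cauchy a (½ ℚ.* ε) (half 0<ε)
          (N , k) = cauchy b (½ ℚ.* ε) (half 0<ε)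
      in M ℕ.⊔ N , λ i j p q →
        dist-+ (approx a i) (approx a j) (approx b i) (approx b j)
          (h i j (⊔ˡ p) (⊔ˡ q)) (k i j (⊔ʳ p) (⊔ʳ q))

    -_ : ℝ → ℝ
    - a = real (λ i → ℚ.- approx a i) λ ε 0<ε →
      let (N , h) = cauchy a ε 0<ε
      in N , λ i j p q →
        subst (ℚ._< ε) (dist-neg (approx a i) (approx a j)) (h i j p q)

    _*_ : ℝ → ℝ → ℝ
    a * b = real (λ i → approx a i ℚ.* approx b i) λ ε 0<ε →
      let (A , 0<A , K , a<A) = bounded a
          (B , 0<B , L , b<B) = bounded b
          (δ₁ , 0<δ₁ , eq₁)   = shrink B (½ ℚ.* ε) 0<B (half 0<ε)
          (δ₂ , 0<δ₂ , eq₂)   = shrink A (½ ℚ.* ε) 0<A (half 0<ε)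
          (M , h)             = cauchy a δ₁ 0<δ₁
          (N , k)             = cauchy b δ₂ 0<δ₂
      in (K ℕ.⊔ L) ℕ.⊔ (M ℕ.⊔ N) , λ i j p q →
        dist-* (approx a i) (approx a j) (approx b i) (approx b j)
          0<A 0<B eq₁ eq₂
          (a<A j (⊔ˡ (⊔ˡ q))) (b<B i (⊔ʳ {K} (⊔ˡ p)))
          (h i j (⊔ˡ (⊔ʳ {K ℕ.⊔ L} p)) (⊔ˡ (⊔ʳ {K ℕ.⊔ L} q)))
          (k i j (⊔ʳ {M} (⊔ʳ {K ℕ.⊔ L} p)) (⊔ʳ {M} (⊔ʳ {K ℕ.⊔ L} q)))

    ≈-sym : ∀ {a b} → a ≈ᵣ b → b ≈ᵣ a
    ≈-sym {a} {b} a≈b ε 0<ε =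
      let (N , h) = a≈b ε 0<ε
      in N , λ i p → subst (ℚ._< ε) (dist-sym (approx a i) (approx b i)) (h i p)

    ≈-trans : ∀ {a b c} → a ≈ᵣ b → b ≈ᵣ c → a ≈ᵣ c
    ≈-trans {a} {b} {c} a≈b b≈c ε 0<ε =
      let (M , h) = a≈b (½ ℚ.* ε) (half 0<ε)
          (N , k) = b≈c (½ ℚ.* ε) (half 0<ε)
      in M ℕ.⊔ N , λ i p →
        dist-trans (approx a i) (approx b i) (approx c i) (h i (⊔ˡ p)) (k i (⊔ʳ p))

    +-cong : ∀ {a a′ b b′} → a ≈ᵣ a′ → b ≈ᵣ b′ → (a + b) ≈ᵣ (a′ + b′)
    +-cong {a} {a′} {b} {b′} a≈a′ b≈b′ ε 0<ε =
      let (M , h) = a≈a′ (½ ℚ.* ε) (half 0<ε)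
          (N , k) = b≈b′ (½ ℚ.* ε) (half 0<ε)
      in M ℕ.⊔ N , λ i p →
        dist-+ (approx a i) (approx a′ i) (approx b i) (approx b′ i)
          (h i (⊔ˡ p)) (k i (⊔ʳ p))

    -‿cong : ∀ {a a′} → a ≈ᵣ a′ → (- a) ≈ᵣ (- a′)
    -‿cong {a} {a′} a≈a′ ε 0<ε =
      let (N , h) = a≈a′ ε 0<ε
      in N , λ i p → subst (ℚ._< ε) (dist-neg (approx a i) (approx a′ i)) (h i p)

    *-cong : ∀ {a a′ b b′} → a ≈ᵣ a′ → b ≈ᵣ b′ → (a * b) ≈ᵣ (a′ * b′)
    *-cong {a} {a′} {b} {b′} a≈a′ b≈b′ ε 0<ε =
      let (A , 0<A , K , a<A) = bounded a′
          (B , 0<B , L , b<B) = bounded b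
          (δ₁ , 0<δ₁ , eq₁)   = shrink B (½ ℚ.* ε) 0<B (half 0<ε)
          (δ₂ , 0<δ₂ , eq₂)   = shrink A (½ ℚ.* ε) 0<A (half 0<ε)
          (M , h)             = a≈a′ δ₁ 0<δ₁
          (N , k)             = b≈b′ δ₂ 0<δ₂
      in (K ℕ.⊔ L) ℕ.⊔ (M ℕ.⊔ N) , λ i p →
        dist-* (approx a i) (approx a′ i) (approx b i) (approx b′ i)
          0<A 0<B eq₁ eq₂
          (a<A i (⊔ˡ (⊔ˡ p))) (b<B i (⊔ʳ {K} (⊔ˡ p)))
          (h i (⊔ˡ (⊔ʳ {K ℕ.⊔ L} p)))
          (k i (⊔ʳ {M} (⊔ʳ {K ℕ.⊔ L} p)))

  ℝ-ring : CommutativeRing 0ℓ 0ℓ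
  ℝ-ring = record
    { Carrier = ℝ
    ; _≈_     = _≈ᵣ_
    ; _+_     = _+_
    ; _*_     = _*_
    ; -_      = -_
    ; 0#      = const 0ℚ
    ; 1#      = const 1ℚ
    ; isCommutativeRing = record
      { isRing = record
        { +-isAbelianGroup = record
          { isGroup = record
            { isMonoid = record
              { isSemigroup = record
                { isMagma = record
                  { isEquivalence = record
                    { refl  = λ {a} → ≡⇒≈ᵣ {a} {a} λ _ → refl
                    ; sym   = λ {a} {b} → ≈-sym {a} {b}
                    ; trans = λ {a} {b} {c} → ≈-trans {a} {b} {c}
                    }
                  ; ∙-cong = λ {a} {a′} {b} {b′} → +-cong {a} {a′} {b} {b′}
                  }
                ; assoc = λ a b c → ≡⇒≈ᵣ {(a + b) + c} {a + (b + c)}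
                    λ i → ℚ.+-assoc (approx a i) (approx b i) (approx c i)
                }
              ; identity = (λ a → ≡⇒≈ᵣ {const 0ℚ + a} {a} λ i → ℚ.+-identityˡ (approx a i))
                         , (λ a → ≡⇒≈ᵣ {a + const 0ℚ} {a} λ i → ℚ.+-identityʳ (approx a i))
              }
            ; inverse = (λ a → ≡⇒≈ᵣ {(- a) + a} {const 0ℚ} λ i → ℚ.+-inverseˡ (approx a i))
                      , (λ a → ≡⇒≈ᵣ {a + (- a)} {const 0ℚ} λ i → ℚ.+-inverseʳ (approx a i))
            ; ⁻¹-cong = λ {a} {b} → -‿cong {a} {b}
            }
          ; comm = λ a b → ≡⇒≈ᵣ {a + b} {b + a} λ i → ℚ.+-comm (approx a i) (approx b i)
          }
        ; *-cong = λ {a} {a′} {b} {b′} → *-cong {a} {a′} {b} {b′}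
        ; *-assoc = λ a b c → ≡⇒≈ᵣ {(a * b) * c} {a * (b * c)}
            λ i → ℚ.*-assoc (approx a i) (approx b i) (approx c i)
        ; *-identity = (λ a → ≡⇒≈ᵣ {const 1ℚ * a} {a} λ i → ℚ.*-identityˡ (approx a i))
                     , (λ a → ≡⇒≈ᵣ {a * const 1ℚ} {a} λ i → ℚ.*-identityʳ (approx a i))
        ; distrib = (λ a b c → ≡⇒≈ᵣ {a * (b + c)} {a * b + a * c}
                       λ i → ℚ.*-distribˡ-+ (approx a i) (approx b i) (approx c i))
                  , (λ a b c → ≡⇒≈ᵣ {(b + c) * a} {b * a + c * a}
                       λ i → ℚ.*-distribʳ-+ (approx a i) (approx b i) (approx c i))
        }
      ; *-comm = λ a b → ≡⇒≈ᵣ {a * b} {b * a} λ i → ℚ.*-comm (approx a i) (approx b i)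
      }
    }

-- The proof of primality is irrelevant, so that a family indexed by ℙ
-- really is a family indexed by the prime numbers.
ℙ : Set
ℙ = [ p ∈ ℕ ∣ Prime p ]

ℤₚ : ℙ → CommutativeRing 0ℓ 0ℓ
ℤₚ p = ℤ-adic (value p)

𝒰[𝔸ℤ] : ℤ → Set
𝒰[𝔸ℤ] m = 𝒰 m ℝ-ring × (∀ p → 𝒰 m (ℤₚ p))

∏ₚ∉ : List ℙ → ℤ → Set
∏ₚ∉ S m = ∀ p → .(p ∉ S) → 𝒰 m (ℤₚ p)

diagonal : ∀ S m → 𝒰 m ℤ-ring → ∏ₚ∉ S m
diagonal S m P p _ =
  𝒰-map ℤ-ring (ℤₚ p) (ℤ→ℤ-adic-isRingHomomorphism (value p)) P

-- The closed ball around P of radius p⁻ᵏ, in the subspace 𝒰ₘ(ℤₚ) of ℤₚ³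
-- (for the maximum of the p-adic distances).
Ball : ∀ {m} p → ℕ → 𝒰 m (ℤₚ p) → Pred (𝒰 m (ℤₚ p)) 0ℓ
Ball p k P Q =
  (P.x ≡ Q.x mod^ k) × (P.y ≡ Q.y mod^ k) × (P.z ≡ Q.z mod^ k)
  where
  module P = 𝒰 P
  module Q = 𝒰 Q

module _ {S : List ℙ} {m : ℤ} where

  -- Neighbourhood basis of the product topology: only the primes in the
  -- finite list T are constrained, and since the balls around a point are
  -- nested, a common exponent k suffices.
  BasicNeighbourhood : List ℙ → ℕ → ∏ₚ∉ S m → Pred (∏ₚ∉ S m) 0ℓ
  BasicNeighbourhood T k P Q =
    ∀ p → p ∈ T → .(p∉S : p ∉ S) → Ball p k (P p p∉S) (Q p p∉S)

  IsOpen : Pred (∏ₚ∉ S m) 0ℓ → Set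
  IsOpen V = ∀ P → V P → ∃[ T ] ∃[ k ] (∀ Q → BasicNeighbourhood T k P Q → V Q)

  HasDenseImage : {A : Set} → (A → ∏ₚ∉ S m) → Set₁
  HasDenseImage {A} f = ∀ V → IsOpen V → ∃ V → ∃ λ (a : A) → V (f a)

module Submission where

open import Defs
open import Algebra.Bundles using (CommutativeRing)
open import Data.Empty using (⊥; ⊥-elim-irr)
open import Data.Integer.Base as ℤ using (ℤ; +_; -[1+_]; 0ℤ; 1ℤ; ∣_∣)
open import Data.Integer.Divisibility.Signed
  using (_∣_; divides; ∣⇒∣ᵤ; ∣ᵤ⇒∣; ∣-trans; ∣m∣n⇒∣m+n; ∣m∣n⇒∣m-n; ∣m⇒∣-m; ∣n⇒∣m*n; ∣m⇒∣m*n)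
import Data.Integer.Properties as ℤ
import Data.Integer.Solver as ℤ
open import Data.Irrelevant using ([_])
open import Data.List.Base using (List; []; _∷_; map)
open import Data.List.Membership.Propositional using (_∈_; _∉_)
open import Data.List.Membership.Propositional.Properties using (∈-map⁺)
open import Data.List.Relation.Unary.All using (universal; module All)
open import Data.List.Relation.Unary.All.Properties using (map⁺)
open import Data.List.Relation.Unary.Any using (here; there)
open import Data.Nat.Base as ℕ using (ℕ; zero; suc; z≤n; s≤s)
import Data.Nat.Divisibility as ℕ
open import Data.Nat.Induction using (Acc; acc; <-wellFounded)
open import Data.Nat.ListAction using (product)
open import Data.Nat.ListAction.Properties using (∈⇒∣product; product≢0)
open import Data.Nat.Primality using (Prime; ¬prime[0]; ¬prime[1])
open import Data.Nat.Primality.Factorisation using (factorise)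
import Data.Nat.Properties as ℕ
import Data.Nat.Solver as ℕ
open import Data.Product using (∃-syntax; _×_; _,_; proj₁; proj₂)
open import Data.Refinement.Base using (value; _,_)
open import Data.Sum.Base using (_⊎_; inj₁; inj₂)
open import Relation.Binary.PropositionalEquality
  using (_≡_; _≢_; refl; sym; trans; cong; cong₂; subst; subst₂)
open import Relation.Nullary using (Dec; yes; no; contradiction)
open import Relation.Nullary.Negation using (¬_)

-- For m ≠ 0 choose two primes p ≠ q outside S for which m is a square, and
-- consider integral points p-adically near (√m, 0, 0) and q-adically near
-- (0, √m, 0).  For such a point pᵏ divides y and z while qᵏ divides x and z,
-- and the Vieta involutions preserve this.  When pᵏ and qᵏ are large, each
-- coordinate is zero or large; the involutions then strictly decrease the
-- largest coordinate until xyz ≤ 0, where x² + y² + z² ≤ m forces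
-- x = y = z = 0, so m = 0.  For m = 0 the same descent shows that a point
-- p-adically near (0, 0, 0) is (0, 0, 0), which is not q-adically near (3, 3, 3).

private
  variable
    x y z m : ℤ

-- The Markoff polynomial and its symmetries.

markoff : ℤ → ℤ → ℤ → ℤ
markoff x y z = x ℤ.* x ℤ.+ y ℤ.* y ℤ.+ z ℤ.* z ℤ.+ ℤ.- (x ℤ.* y ℤ.* z)

module _ where
  open ℤ.+-*-Solver

  private
    markoff′ : ∀ {n} → Polynomial n → Polynomial n → Polynomial n → Polynomial n
    markoff′ x y z = x :* x :+ y :* y :+ z :* z :+ :- (x :* y :* z)

  markoff-rotate : ∀ x y z → markoff y z x ≡ markoff x y z
  markoff-rotate = solve 3 (λ x y z → markoff′ y z x := markoff′ x y z) refl

  -- As a quadratic in `z` the polynomial has linear coefficient `-xy`, so it takes the same value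
  -- at `z` and at `xy - z`.
  markoff-vieta : ∀ x y z → markoff x y (x ℤ.* y ℤ.- z) ≡ markoff x y z
  markoff-vieta = solve 3 (λ x y z → markoff′ x y (x :* y :- z) := markoff′ x y z) refl

-- Size estimates for a Vieta move.

-- If `2c ≤ ab`, put `t = abc`: then `a²`, `b²`, `c²`, `μ` are at most `t/6`, `t/6`, `t/2`, `t/6`,
-- the last strictly, and their sum is less than `t`. The constant 6 makes these fractions total 1.
ab<2c : ∀ {a b c μ} → 6 ℕ.≤ a → 6 ℕ.≤ b → a ℕ.≤ c → b ℕ.≤ c → μ ℕ.< c →
        a ℕ.* b ℕ.* c ℕ.≤ a ℕ.* a ℕ.+ b ℕ.* b ℕ.+ c ℕ.* c ℕ.+ μ →
        a ℕ.* b ℕ.< 2 ℕ.* c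
ab<2c {a} {b} {c} {μ} 6≤a 6≤b a≤c b≤c μ<c abc≤ = ℕ.≰⇒> λ 2c≤ab →
  ℕ.<-irrefl refl (begin-strict
    6 ℕ.* t
      ≤⟨ ℕ.*-monoʳ-≤ 6 abc≤ ⟩
    6 ℕ.* (a ℕ.* a ℕ.+ b ℕ.* b ℕ.+ c ℕ.* c ℕ.+ μ)
      ≡⟨ solve 4 (λ a b c μ → con 6 :* (a :* a :+ b :* b :+ c :* c :+ μ) :=
           con 6 :* (a :* a) :+ con 6 :* (b :* b) :+ con 3 :* (con 2 :* c :* c)
             :+ con 6 :* μ) refl a b c μ ⟩
    6 ℕ.* (a ℕ.* a) ℕ.+ 6 ℕ.* (b ℕ.* b) ℕ.+ 3 ℕ.* (2 ℕ.* c ℕ.* c) ℕ.+ 6 ℕ.* μ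
      <⟨ ℕ.+-mono-≤-< (ℕ.+-mono-≤ (ℕ.+-mono-≤ 6a²≤t 6b²≤t)
           (ℕ.*-monoʳ-≤ 3 (ℕ.*-monoˡ-≤ c 2c≤ab))) 6μ<t ⟩
    t ℕ.+ t ℕ.+ 3 ℕ.* t ℕ.+ t
      ≡⟨ solve 1 (λ t → t :+ t :+ con 3 :* t :+ t := con 6 :* t) refl t ⟩
    6 ℕ.* t ∎)
  where
  open ℕ.≤-Reasoning
  open ℕ.+-*-Solver
  t = a ℕ.* b ℕ.* c
  6a²≤t : 6 ℕ.* (a ℕ.* a) ℕ.≤ t
  6a²≤t = subst (6 ℕ.* (a ℕ.* a) ℕ.≤_)
    (solve 3 (λ a b c → b :* (a :* c) := a :* b :* c) refl a b c)
    (ℕ.*-mono-≤ 6≤b (ℕ.*-monoʳ-≤ a a≤c))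
  6b²≤t : 6 ℕ.* (b ℕ.* b) ℕ.≤ t
  6b²≤t = subst (6 ℕ.* (b ℕ.* b) ℕ.≤_) (sym (ℕ.*-assoc a b c))
    (ℕ.*-mono-≤ 6≤a (ℕ.*-monoʳ-≤ b b≤c))
  6μ<t : 6 ℕ.* μ ℕ.< t
  6μ<t = ℕ.<-≤-trans (ℕ.*-monoʳ-< 6 μ<c) (ℕ.*-monoˡ-≤ c
    (ℕ.*-mono-≤ 6≤a (ℕ.≤-trans (s≤s z≤n) 6≤b)))

∣m⊖n∣<n : ∀ {m n} → 0 ℕ.< m → m ℕ.< 2 ℕ.* n → ∣ m ℤ.⊖ n ∣ ℕ.< n
∣m⊖n∣<n {m} {n} 0<m m<2n with ℕ.≤-total m n
... | inj₁ m≤n rewrite ℤ.∣⊖∣-≤ m≤n = ℕ.∸-monoʳ-< 0<m m≤n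
... | inj₂ n≤m rewrite ℤ.⊖-≥ n≤m = ℕ.m<n+o⇒m∸n<o m n {{ℕ.>-nonZero 0<n}}
        (subst (λ k → m ℕ.< n ℕ.+ k) (ℕ.+-identityʳ n) m<2n)
  where
  0<n : 0 ℕ.< n
  0<n = ℕ.*-cancelˡ-< 2 0 n (ℕ.<-trans 0<m m<2n)

-- The equation `+ ∣ d ℤ.* e ∣ ≡ d ℤ.* e` encodes `de ≥ 0`. Then `|d - e|` is the distance between
-- `|d|` and `|e|`, where `0 < |d| < 2|e|`.
∣d-e∣<∣e∣ : ∀ d e → d ≢ 0ℤ → + ∣ d ℤ.* e ∣ ≡ d ℤ.* e → ∣ d ∣ ℕ.< 2 ℕ.* ∣ e ∣ →
            ∣ d ℤ.- e ∣ ℕ.< ∣ e ∣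
∣d-e∣<∣e∣ (+ zero)       e              d≢0 _ _ = contradiction refl d≢0
∣d-e∣<∣e∣ (+ suc m)      (+ suc n)      _ _ h = ∣m⊖n∣<n (s≤s z≤n) h
∣d-e∣<∣e∣ d@(+ suc _)    (+ zero)       _ _ h = contradiction h λ ()
∣d-e∣<∣e∣ (+ suc m)      -[1+ n ]       _ () h
∣d-e∣<∣e∣ -[1+ m ]       (+ zero)       _ _ h = contradiction h λ ()
∣d-e∣<∣e∣ -[1+ m ]       (+ suc n)      _ () h
∣d-e∣<∣e∣ -[1+ m ]       -[1+ n ]       _ _ h =
  subst (ℕ._< suc n) (ℤ.∣m⊖n∣≡∣n⊖m∣ (suc m) (suc n)) (∣m⊖n∣<n (s≤s z≤n) h)

∣xyz∣≤ : ∀ x y z → markoff x y z ≡ m →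
  ∣ x ∣ ℕ.* ∣ y ∣ ℕ.* ∣ z ∣ ℕ.≤
  ∣ x ∣ ℕ.* ∣ x ∣ ℕ.+ ∣ y ∣ ℕ.* ∣ y ∣ ℕ.+ ∣ z ∣ ℕ.* ∣ z ∣ ℕ.+ ∣ m ∣
∣xyz∣≤ {m} x y z eq = begin
  ∣ x ∣ ℕ.* ∣ y ∣ ℕ.* ∣ z ∣
    ≡⟨ cong (ℕ._* ∣ z ∣) (ℤ.abs-* x y) ⟨
  ∣ x ℤ.* y ∣ ℕ.* ∣ z ∣
    ≡⟨ ℤ.abs-* (x ℤ.* y) z ⟨
  ∣ x ℤ.* y ℤ.* z ∣
    ≡⟨ cong ∣_∣ (solve 2 (λ s t → t := s :- (s :+ :- t)) refl squares (x ℤ.* y ℤ.* z)) ⟩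
  ∣ squares ℤ.- markoff x y z ∣
    ≡⟨ cong (λ t → ∣ squares ℤ.- t ∣) eq ⟩
  ∣ squares ℤ.- m ∣
    ≤⟨ ℤ.∣i-j∣≤∣i∣+∣j∣ squares m ⟩
  ∣ squares ∣ ℕ.+ ∣ m ∣
    ≤⟨ ℕ.+-monoˡ-≤ ∣ m ∣ (ℤ.∣i+j∣≤∣i∣+∣j∣ (x ℤ.* x ℤ.+ y ℤ.* y) (z ℤ.* z)) ⟩
  ∣ x ℤ.* x ℤ.+ y ℤ.* y ∣ ℕ.+ ∣ z ℤ.* z ∣ ℕ.+ ∣ m ∣
    ≤⟨ ℕ.+-monoˡ-≤ ∣ m ∣ (ℕ.+-monoˡ-≤ ∣ z ℤ.* z ∣ (ℤ.∣i+j∣≤∣i∣+∣j∣ (x ℤ.* x) (y ℤ.* y))) ⟩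
  ∣ x ℤ.* x ∣ ℕ.+ ∣ y ℤ.* y ∣ ℕ.+ ∣ z ℤ.* z ∣ ℕ.+ ∣ m ∣
    ≡⟨ cong (ℕ._+ ∣ m ∣) (cong₂ ℕ._+_ (cong₂ ℕ._+_ (ℤ.abs-* x x) (ℤ.abs-* y y)) (ℤ.abs-* z z)) ⟩
  ∣ x ∣ ℕ.* ∣ x ∣ ℕ.+ ∣ y ∣ ℕ.* ∣ y ∣ ℕ.+ ∣ z ∣ ℕ.* ∣ z ∣ ℕ.+ ∣ m ∣ ∎
  where
  open ℕ.≤-Reasoning
  open ℤ.+-*-Solver
  squares = x ℤ.* x ℤ.+ y ℤ.* y ℤ.+ z ℤ.* z

-- All that the size estimates retain of divisibility by a number at least `B`.
ZeroOr≥ : ℕ → ℤ → Set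
ZeroOr≥ B x = x ≡ 0ℤ ⊎ B ℕ.≤ ∣ x ∣

square≤⇒0 : ∀ {B} x → ZeroOr≥ B x → ∣ x ∣ ℕ.* ∣ x ∣ ℕ.< B → x ≡ 0ℤ
square≤⇒0 x        (inj₁ x≡0) _ = x≡0
square≤⇒0 (+ zero) (inj₂ _)   _ = refl
square≤⇒0 x@(+ suc n) (inj₂ B≤x) h =
  contradiction (ℕ.≤-trans B≤x (ℕ.m≤m*n ∣ x ∣ ∣ x ∣)) (ℕ.<⇒≱ h)
square≤⇒0 x@(-[1+ n ]) (inj₂ B≤x) h =
  contradiction (ℕ.≤-trans B≤x (ℕ.m≤m*n ∣ x ∣ ∣ x ∣)) (ℕ.<⇒≱ h)

-- For `xyz ≤ 0` the equation reads `x² + y² + z² + |xyz| = m`, so each square is at most `|m| < B`,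
-- whereas a nonzero coordinate has square at least `B`.
xyz≤0⇒0 : ∀ {B} x y z → ∣ m ∣ ℕ.< B → ZeroOr≥ B x → ZeroOr≥ B y → ZeroOr≥ B z →
  markoff x y z ≡ m → + ∣ x ℤ.* y ℤ.* z ∣ ≡ ℤ.- (x ℤ.* y ℤ.* z) →
  x ≡ 0ℤ × y ≡ 0ℤ × z ≡ 0ℤ
xyz≤0⇒0 {m} {B} x y z m<B hx hy hz eq sgn =
    square≤⇒0 x hx (below (ℕ.≤-trans (ℕ.m≤m+n X Y) X+Y≤))
  , square≤⇒0 y hy (below (ℕ.≤-trans (ℕ.m≤n+m Y X) X+Y≤))
  , square≤⇒0 z hz (below (ℕ.≤-trans (ℕ.m≤n+m Z (X ℕ.+ Y)) (ℕ.m≤m+n (X ℕ.+ Y ℕ.+ Z) W)))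
  where
  X = ∣ x ∣ ℕ.* ∣ x ∣
  Y = ∣ y ∣ ℕ.* ∣ y ∣
  Z = ∣ z ∣ ℕ.* ∣ z ∣
  W = ∣ x ℤ.* y ℤ.* z ∣
  X+Y≤ : X ℕ.+ Y ℕ.≤ X ℕ.+ Y ℕ.+ Z ℕ.+ W
  X+Y≤ = ℕ.≤-trans (ℕ.m≤m+n (X ℕ.+ Y) Z) (ℕ.m≤m+n (X ℕ.+ Y ℕ.+ Z) W)
  square : ∀ i → + (∣ i ∣ ℕ.* ∣ i ∣) ≡ i ℤ.* i
  square (+ n)    = sym (ℤ.+◃n≡+n _)
  square -[1+ n ] = refl
  m≡ : X ℕ.+ Y ℕ.+ Z ℕ.+ W ≡ ∣ m ∣
  m≡ = trans (cong ∣_∣ (cong₂ ℤ._+_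
         (cong₂ ℤ._+_ (cong₂ ℤ._+_ (square x) (square y)) (square z)) sgn))
       (cong ∣_∣ eq)
  below : ∀ {n} → n ℕ.≤ X ℕ.+ Y ℕ.+ Z ℕ.+ W → n ℕ.< B
  below h = ℕ.≤-<-trans (subst (_ ℕ.≤_) m≡ h) m<B

-- `ab<2c` gives `|xy| < 2|z|`, and `xyz ≥ 0` gives `xy` and `z` the same sign, so `xy` lies
-- strictly between 0 and `2z`.
vieta-smaller : ∀ {B} x y z → 6 ℕ.≤ B → ∣ m ∣ ℕ.< B →
  B ℕ.≤ ∣ x ∣ → B ℕ.≤ ∣ y ∣ → ∣ x ∣ ℕ.≤ ∣ z ∣ → ∣ y ∣ ℕ.≤ ∣ z ∣ →
  markoff x y z ≡ m → + ∣ x ℤ.* y ℤ.* z ∣ ≡ x ℤ.* y ℤ.* z →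
  ∣ x ℤ.* y ℤ.- z ∣ ℕ.< ∣ z ∣
vieta-smaller {m} {B} x y z 6≤B m<B B≤x B≤y x≤z y≤z eq sgn =
  ∣d-e∣<∣e∣ (x ℤ.* y) z xy≢0 sgn (subst (ℕ._< 2 ℕ.* ∣ z ∣) (sym (ℤ.abs-* x y))
    (ab<2c (ℕ.≤-trans 6≤B B≤x) (ℕ.≤-trans 6≤B B≤y) x≤z y≤z
      (ℕ.<-≤-trans m<B (ℕ.≤-trans B≤x x≤z)) (∣xyz∣≤ x y z eq)))
  where
  0<_ : ∀ {i} → B ℕ.≤ ∣ i ∣ → 0 ℕ.< ∣ i ∣
  0< h = ℕ.≤-trans (s≤s z≤n) (ℕ.≤-trans 6≤B h)
  xy≢0 : x ℤ.* y ≢ 0ℤ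
  xy≢0 xy≡0 = ℕ.<-irrefl (trans (sym (cong ∣_∣ xy≡0)) (ℤ.abs-* x y))
    (ℕ.*-mono-≤ (0<_ {x} B≤x) (0<_ {y} B≤y))

+∣0∣≡-0 : ∀ {i} → i ≡ 0ℤ → + ∣ i ∣ ≡ ℤ.- i
+∣0∣≡-0 refl = refl

-- Carries vanishing back through a Vieta move that keeps `i`, `j` and replaces `k`.
minuend≡0⇒subtrahend≡0 : ∀ i j k → i ≡ 0ℤ → i ℤ.* j ℤ.- k ≡ 0ℤ → k ≡ 0ℤ
minuend≡0⇒subtrahend≡0 i j k refl h =
  trans (sym (ℤ.i-j≡0⇒i≡j _ k h)) (ℤ.*-zeroˡ j)

-- Descent along the Vieta involutions.

module _ {B} (6≤B : 6 ℕ.≤ B) (m<B : ∣ m ∣ ℕ.< B)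
  (Inv : ℤ → ℤ → ℤ → Set)
  (zeroOr≥ : ∀ {x y z} → Inv x y z → ZeroOr≥ B x × ZeroOr≥ B y × ZeroOr≥ B z)
  (vieta-x : ∀ {x y z} → Inv x y z → Inv (y ℤ.* z ℤ.- x) y z)
  (vieta-y : ∀ {x y z} → Inv x y z → Inv x (z ℤ.* x ℤ.- y) z)
  (vieta-z : ∀ {x y z} → Inv x y z → Inv x y (x ℤ.* y ℤ.- z))
  where

  private
    -- The sum, unlike the maximum, drops strictly even when two coordinates tie for largest.
    size : ℤ → ℤ → ℤ → ℕ
    size x y z = ∣ x ∣ ℕ.+ ∣ y ∣ ℕ.+ ∣ z ∣

    Vanishes : ℤ → ℤ → ℤ → Set
    Vanishes x y z = x ≡ 0ℤ × y ≡ 0ℤ × z ≡ 0ℤ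

    module Step (x y z : ℤ) (inv : Inv x y z) (eq : markoff x y z ≡ m)
      (rec : ∀ x′ y′ z′ → size x′ y′ z′ ℕ.< size x y z →
             Inv x′ y′ z′ → markoff x′ y′ z′ ≡ m → Vanishes x′ y′ z′)
      where

      eq₁ : markoff y z x ≡ m
      eq₁ = trans (markoff-rotate x y z) eq

      eq₂ : markoff z x y ≡ m
      eq₂ = trans (markoff-rotate y z x) eq₁

      reduce-z : ∣ x ℤ.* y ℤ.- z ∣ ℕ.< ∣ z ∣ → Vanishes x y z
      reduce-z lt =
        let (x≡0 , y≡0 , z′≡0) = rec x y (x ℤ.* y ℤ.- z) (ℕ.+-monoʳ-< (∣ x ∣ ℕ.+ ∣ y ∣) lt)
              (vieta-z inv) (trans (markoff-vieta x y z) eq)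
        in x≡0 , y≡0 , minuend≡0⇒subtrahend≡0 x y z x≡0 z′≡0

      reduce-x : ∣ y ℤ.* z ℤ.- x ∣ ℕ.< ∣ x ∣ → Vanishes x y z
      reduce-x lt =
        let (x′≡0 , y≡0 , z≡0) = rec (y ℤ.* z ℤ.- x) y z
              (ℕ.+-monoˡ-< ∣ z ∣ (ℕ.+-monoˡ-< ∣ y ∣ lt)) (vieta-x inv)
              -- `markoff-vieta` moves the last coordinate, so the triple is rotated to bring `x`
              -- there.
              (trans (sym (markoff-rotate (y ℤ.* z ℤ.- x) y z)) (trans (markoff-vieta y z x) eq₁))
        in minuend≡0⇒subtrahend≡0 y z x y≡0 x′≡0 , y≡0 , z≡0

      reduce-y : ∣ z ℤ.* x ℤ.- y ∣ ℕ.< ∣ y ∣ → Vanishes x y z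
      reduce-y lt =
        let (x≡0 , y′≡0 , z≡0) = rec x (z ℤ.* x ℤ.- y) z
              (ℕ.+-monoˡ-< ∣ z ∣ (ℕ.+-monoʳ-< ∣ x ∣ lt)) (vieta-y inv)
              (trans (markoff-rotate z x (z ℤ.* x ℤ.- y)) (trans (markoff-vieta z x y) eq₂))
        in x≡0 , minuend≡0⇒subtrahend≡0 z x y z≡0 y′≡0 , z≡0

      module _ (B≤x : B ℕ.≤ ∣ x ∣) (B≤y : B ℕ.≤ ∣ y ∣) (B≤z : B ℕ.≤ ∣ z ∣)
        (xyz>0 : + ∣ x ℤ.* y ℤ.* z ∣ ≡ x ℤ.* y ℤ.* z) where

        yzx>0 : + ∣ y ℤ.* z ℤ.* x ∣ ≡ y ℤ.* z ℤ.* x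
        yzx>0 = subst (λ t → + ∣ t ∣ ≡ t)
          (trans (ℤ.*-assoc x y z) (ℤ.*-comm x (y ℤ.* z))) xyz>0

        zxy>0 : + ∣ z ℤ.* x ℤ.* y ∣ ≡ z ℤ.* x ℤ.* y
        zxy>0 = subst (λ t → + ∣ t ∣ ≡ t)
          (trans (ℤ.*-comm (x ℤ.* y) z) (sym (ℤ.*-assoc z x y))) xyz>0

        x-largest : ∣ y ∣ ℕ.≤ ∣ x ∣ → ∣ z ∣ ℕ.≤ ∣ x ∣ → Vanishes x y z
        x-largest y≤x z≤x =
          reduce-x (vieta-smaller y z x 6≤B m<B B≤y B≤z y≤x z≤x eq₁ yzx>0)

        y-largest : ∣ z ∣ ℕ.≤ ∣ y ∣ → ∣ x ∣ ℕ.≤ ∣ y ∣ → Vanishes x y z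
        y-largest z≤y x≤y =
          reduce-y (vieta-smaller z x y 6≤B m<B B≤z B≤x z≤y x≤y eq₂ zxy>0)

        z-largest : ∣ x ∣ ℕ.≤ ∣ z ∣ → ∣ y ∣ ℕ.≤ ∣ z ∣ → Vanishes x y z
        z-largest x≤z y≤z =
          reduce-z (vieta-smaller x y z 6≤B m<B B≤x B≤y x≤z y≤z eq xyz>0)

        large : Vanishes x y z
        large with ℕ.≤-total ∣ x ∣ ∣ y ∣ | ℕ.≤-total ∣ y ∣ ∣ z ∣ | ℕ.≤-total ∣ x ∣ ∣ z ∣
        ... | _        | inj₁ y≤z | inj₁ x≤z = z-largest x≤z y≤z
        ... | inj₁ x≤y | inj₂ z≤y | _        = y-largest z≤y x≤y
        ... | inj₂ y≤x | _        | inj₂ z≤x = x-largest y≤x z≤x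
        -- In the last two cases the comparisons form a cycle: all three sizes agree and any
        -- coordinate is largest.
        ... | inj₁ x≤y | inj₁ y≤z | inj₂ _   = z-largest (ℕ.≤-trans x≤y y≤z) y≤z
        ... | inj₂ y≤x | inj₂ z≤y | inj₁ _   = x-largest y≤x (ℕ.≤-trans z≤y y≤x)

      module _ (hx : ZeroOr≥ B x) (hy : ZeroOr≥ B y) (hz : ZeroOr≥ B z) where

        nonpositive : + ∣ x ℤ.* y ℤ.* z ∣ ≡ ℤ.- (x ℤ.* y ℤ.* z) → Vanishes x y z
        nonpositive = xyz≤0⇒0 x y z m<B hx hy hz eq

        -- A zero coordinate gives `xyz = 0`, which `nonpositive` covers; otherwise all coordinates
        -- are large and a move applies.
        nonnegative : ZeroOr≥ B x → ZeroOr≥ B y → ZeroOr≥ B z →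
          + ∣ x ℤ.* y ℤ.* z ∣ ≡ x ℤ.* y ℤ.* z → Vanishes x y z
        nonnegative (inj₁ x≡0) _ _ _ = nonpositive (+∣0∣≡-0
          (trans (cong (λ t → t ℤ.* y ℤ.* z) x≡0)
            (trans (cong (ℤ._* z) (ℤ.*-zeroˡ y)) (ℤ.*-zeroˡ z))))
        nonnegative (inj₂ _) (inj₁ y≡0) _ _ = nonpositive (+∣0∣≡-0
          (trans (cong (λ t → x ℤ.* t ℤ.* z) y≡0)
            (trans (cong (ℤ._* z) (ℤ.*-zeroʳ x)) (ℤ.*-zeroˡ z))))
        nonnegative (inj₂ _) (inj₂ _) (inj₁ z≡0) _ = nonpositive (+∣0∣≡-0
          (trans (cong (λ t → x ℤ.* y ℤ.* t) z≡0) (ℤ.*-zeroʳ (x ℤ.* y))))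
        nonnegative (inj₂ B≤x) (inj₂ B≤y) (inj₂ B≤z) xyz>0 = large B≤x B≤y B≤z xyz>0

        step : Vanishes x y z
        step with ℤ.+∣i∣≡i⊎+∣i∣≡-i (x ℤ.* y ℤ.* z)
        ... | inj₁ sgn = nonnegative hx hy hz sgn
        ... | inj₂ sgn = nonpositive sgn

    descend : ∀ x y z → Acc ℕ._<_ (size x y z) → Inv x y z → markoff x y z ≡ m → Vanishes x y z
    descend x y z (acc rec) inv eq =
      let (hx , hy , hz) = zeroOr≥ inv
      in Step.step x y z inv eq (λ x′ y′ z′ lt → descend x′ y′ z′ (rec lt)) hx hy hz

  markoff-descent : ∀ x y z → Inv x y z → markoff x y z ≡ m → x ≡ 0ℤ × y ≡ 0ℤ × z ≡ 0ℤ
  markoff-descent x y z = descend x y z (<-wellFounded _)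

-- Hensel lifting of square roots.

∣-* : ∀ {d e i j} → d ∣ i → e ∣ j → d ℤ.* e ∣ i ℤ.* j
∣-* {d} {e} (divides q refl) (divides r refl) = divides (q ℤ.* r)
  (solve 4 (λ q d r e → (q :* d) :* (r :* e) := (q :* r) :* (d :* e)) refl q d r e)
  where open ℤ.+-*-Solver

p^n∣p^[1+n] : ∀ p n → + (p ℕ.^ n) ∣ + (p ℕ.^ suc n)
p^n∣p^[1+n] p n = divides (+ p) (ℤ.pos-* p (p ℕ.^ n))

SquareRootMod : ℤ → ℤ → ℤ → Set
SquareRootMod m d s = d ∣ s ℤ.* s ℤ.- m

-- `u` inverts the derivative `2s` modulo `p`; carrying it as data keeps Newton's iteration free of
-- division.
record LiftableRoot (p : ℕ) (m : ℤ) : Set where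
  field
    s u        : ℤ
    root       : SquareRootMod m (+ p) s
    invertible : + p ∣ 1ℤ ℤ.- + 2 ℤ.* s ℤ.* u

module Hensel {p m} (r₀ : LiftableRoot p m) where
  open LiftableRoot r₀ renaming (s to s₀; root to root₀; invertible to invertible₀)
  open ℤ.+-*-Solver

  record Approximation (n : ℕ) : Set where
    field
      s          : ℤ
      root       : SquareRootMod m (+ (p ℕ.^ suc n)) s
      invertible : + p ∣ 1ℤ ℤ.- + 2 ℤ.* s ℤ.* u

  open Approximation

  error : ∀ {n} → Approximation n → ℤ
  error a = s a ℤ.* s a ℤ.- m

  p∣p^[1+n] : ∀ n → + p ∣ + (p ℕ.^ suc n)
  p∣p^[1+n] n = ∣ᵤ⇒∣ (ℕ.m∣m*n (p ℕ.^ n))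

  -- With `f = s² - m` the new error is `(1 - 2su + fu²) f`: `p` divides the first factor and
  -- `p^(n+1)` the second. As `p` divides the correction `fu`, `u` still inverts twice the new root
  -- modulo `p`.
  newton : ∀ {n} → Approximation n → Approximation (suc n)
  newton {n} a .s = s a ℤ.- error a ℤ.* u
  newton {n} a .root = subst₂ _∣_
    (sym (ℤ.pos-* p (p ℕ.^ suc n)))
    (solve 3 (λ s u m → let f = s :* s :- m in
        ((con 1ℤ :- con (+ 2) :* s :* u) :+ f :* (u :* u)) :* f :=
        (s :- f :* u) :* (s :- f :* u) :- m) refl (s a) u m)
    (∣-* (∣m∣n⇒∣m+n (invertible a) (∣m⇒∣m*n (u ℤ.* u) (∣-trans (p∣p^[1+n] n) (root a))))
         (root a))
  newton {n} a .invertible = subst (+ p ∣_)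
    (solve 3 (λ s u f →
        (con 1ℤ :- con (+ 2) :* s :* u) :+ f :* (con (+ 2) :* u :* u) :=
        con 1ℤ :- con (+ 2) :* (s :- f :* u) :* u) refl (s a) u (error a))
    (∣m∣n⇒∣m+n (invertible a)
      (∣m⇒∣m*n (+ 2 ℤ.* u ℤ.* u) (∣-trans (p∣p^[1+n] n) (root a))))

  approximation : ∀ n → Approximation n
  approximation zero .s          = s₀
  approximation zero .root       = subst (λ k → SquareRootMod m (+ k) s₀)
    (sym (ℕ.*-identityʳ p)) root₀
  approximation zero .invertible = invertible₀
  approximation (suc n) = newton (approximation n)

  √m : ℤ[ p ]
  √m = adic (λ n → s (approximation n)) λ n → let a = approximation n in
    subst (+ (p ℕ.^ n) ∣_)
      (solve 2 (λ s e → :- e := (s :- e) :- s) refl (s a) (error a ℤ.* u))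
      -- The error at stage `n` is divisible by `p^(n+1)`, one power more than coherence asks.
      (∣m⇒∣-m (∣m⇒∣m*n u (∣-trans (p^n∣p^[1+n] p n) (root a))))

  √m² : ∀ n → SquareRootMod m (+ (p ℕ.^ n)) (residue √m n)
  √m² n = ∣-trans (p^n∣p^[1+n] p n) (root (approximation n))

-- Local points with one coordinate a square root of `m`.

n·1≡+n : ∀ n → fromℤ ℤ-ring (+ n) ≡ + n
n·1≡+n zero    = refl
n·1≡+n (suc n) = cong (λ k → 1ℤ ℤ.+ k) (n·1≡+n n)

fromℤ-ℤ : ∀ m → fromℤ ℤ-ring m ≡ m
fromℤ-ℤ (+ n)    = n·1≡+n n
fromℤ-ℤ -[1+ n ] = cong ℤ.-_ (n·1≡+n (suc n))

-- The hypothesis uses the integer `m` itself, while `𝒰` builds `m` from the unit of the ring; the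
-- homomorphism from ℤ identifies the two.
adic-point : ∀ {p} (x y z : ℤ[ p ]) →
  (∀ n → + (p ℕ.^ n) ∣ markoff (residue x n) (residue y n) (residue z n) ℤ.- m) →
  𝒰 m (ℤ-adic p)
adic-point {m} {p} x y z h = point x y z
  (trans′ {F} {ℤ→ℤ-adic p m} {fromℤ (ℤ-adic p) m} h
    (subst (λ k → ℤ→ℤ-adic p k ≈ₚ fromℤ (ℤ-adic p) m) (fromℤ-ℤ m)
      (fromℤ-homo ℤ-ring (ℤ-adic p) (ℤ→ℤ-adic-isRingHomomorphism p) m)))
  where
  open CommutativeRing (ℤ-adic p) renaming (trans to trans′)
  F = x * x + y * y + z * z + - (x * y * z)

markoff[x,0,0] : ∀ x → markoff x 0ℤ 0ℤ ≡ x ℤ.* x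
markoff[x,0,0] = solve 1
  (λ x → x :* x :+ con 0ℤ :+ con 0ℤ :+ :- (x :* con 0ℤ :* con 0ℤ) := x :* x) refl
  where open ℤ.+-*-Solver

module _ {p m} (r : LiftableRoot p m) where
  open Hensel r using (√m; √m²)

  private
    0ₚ : ℤ[ p ]
    0ₚ = ℤ→ℤ-adic p 0ℤ

  [√m,0,0] : 𝒰 m (ℤ-adic p)
  [√m,0,0] = adic-point √m 0ₚ 0ₚ λ n →
    subst (λ k → + (p ℕ.^ n) ∣ k ℤ.- m) (sym (markoff[x,0,0] (residue √m n))) (√m² n)

  [0,√m,0] : 𝒰 m (ℤ-adic p)
  [0,√m,0] = adic-point 0ₚ √m 0ₚ λ n →
    subst (λ k → + (p ℕ.^ n) ∣ k ℤ.- m)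
      (sym (trans (sym (markoff-rotate 0ℤ (residue √m n) 0ℤ)) (markoff[x,0,0] (residue √m n))))
      (√m² n)

-- Primes outside `S` modulo which `m` is a square.

2≤value : ∀ (p : ℙ) → 2 ℕ.≤ value p
2≤value (zero        , [ p-prime ]) = ⊥-elim-irr (¬prime[0] p-prime)
2≤value (suc zero    , [ p-prime ]) = ⊥-elim-irr (¬prime[1] p-prime)
2≤value (suc (suc _) , _)           = s≤s (s≤s z≤n)

prime-divisor : ∀ n → 2 ℕ.≤ n → ∃[ p ] value {P = Prime} p ℕ.∣ n
prime-divisor n 2≤n with factorise n {{ℕ.>-nonZero (ℕ.<⇒≤ 2≤n)}}
... | record { factors = []; isFactorisation = refl } = contradiction 2≤n λ { (s≤s ()) }
... | record { factors = p ∷ ps; isFactorisation = refl; factorsPrime = p-prime All.∷ _ } =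
  (p , [ p-prime ]) , ℕ.m∣m*n (product ps)

p∤1 : ∀ (p : ℙ) → ¬ + value p ∣ 1ℤ
p∤1 p p∣1 = ℕ.<⇒≱ (2≤value p) (ℕ.∣⇒≤ (∣⇒∣ᵤ p∣1))

-- Take a prime p dividing 1 - 4mN², where N is the product of S.  Modulo p,
-- 2mN is a square root of m and N is the inverse of 2 · 2mN.
split-prime : ∀ m → m ≢ 0ℤ → (S : List ℙ) →
  ∃[ p ] p ∉ S × ¬ (+ value p ∣ m) × LiftableRoot (value p) m
split-prime m m≢0 S = p , p∉S , p∤m , record
  { s          = + 2 ℤ.* m ℤ.* N
  ; u          = N
  ; root       = subst (+ value p ∣_)
      (solve 2 (λ m N → :- m :* (con 1ℤ :- con (+ 2) :* (con (+ 2) :* m :* N) :* N) :=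
        (con (+ 2) :* m :* N) :* (con (+ 2) :* m :* N) :- m) refl m N)
      (∣n⇒∣m*n (ℤ.- m) p∣D)
  ; invertible = p∣D
  }
  where
  open ℤ.+-*-Solver
  primes = map value S
  N = + product primes
  E = + 2 ℤ.* (+ 2 ℤ.* m ℤ.* N) ℤ.* N
  D = 1ℤ ℤ.- E

  instance
    N≢0 : ℕ.NonZero (product primes)
    N≢0 = product≢0 (map⁺ (universal (λ q → ℕ.>-nonZero (ℕ.<⇒≤ (2≤value q))) S))
    m-nonZero : ℕ.NonZero ∣ m ∣
    m-nonZero = ℕ.≢-nonZero λ ∣m∣≡0 → m≢0 (ℤ.∣i∣≡0⇒i≡0 ∣m∣≡0)

  -- For either sign of `m` this keeps `D` away from 0 and the units, so a prime divisor exists.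
  4≤∣E∣ : 4 ℕ.≤ ∣ E ∣
  4≤∣E∣ = begin
    4
      ≤⟨ ℕ.*-monoʳ-≤ 4 (ℕ.*-mono-≤ (ℕ.*-mono-≤ (ℕ.>-nonZero⁻¹ ∣ m ∣) 0<N) 0<N) ⟩
    4 ℕ.* (∣ m ∣ ℕ.* ∣ N ∣ ℕ.* ∣ N ∣)
      ≡⟨ cong (λ t → 4 ℕ.* (t ℕ.* ∣ N ∣)) (ℤ.abs-* m N) ⟨
    4 ℕ.* (∣ m ℤ.* N ∣ ℕ.* ∣ N ∣)
      ≡⟨ cong (4 ℕ.*_) (ℤ.abs-* (m ℤ.* N) N) ⟨
    4 ℕ.* ∣ m ℤ.* N ℤ.* N ∣
      ≡⟨ ℤ.abs-* (+ 4) (m ℤ.* N ℤ.* N) ⟨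
    ∣ + 4 ℤ.* (m ℤ.* N ℤ.* N) ∣
      ≡⟨ cong ∣_∣ (solve 2 (λ m N → con (+ 4) :* (m :* N :* N) :=
           con (+ 2) :* (con (+ 2) :* m :* N) :* N) refl m N) ⟩
    ∣ E ∣ ∎
    where
    open ℕ.≤-Reasoning
    0<N : 0 ℕ.< product primes
    0<N = ℕ.>-nonZero⁻¹ _

  2≤∣D∣ : 2 ℕ.≤ ∣ D ∣
  2≤∣D∣ = ℕ.≤-trans (s≤s (s≤s z≤n)) (ℕ.≤-pred (begin
    4               ≤⟨ 4≤∣E∣ ⟩
    ∣ E ∣           ≡⟨ cong ∣_∣ (solve 1 (λ e → e := con 1ℤ :- (con 1ℤ :- e)) refl E) ⟩
    ∣ 1ℤ ℤ.- D ∣    ≤⟨ ℤ.∣i-j∣≤∣i∣+∣j∣ 1ℤ D ⟩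
    suc ∣ D ∣       ∎))
    where open ℕ.≤-Reasoning

  divisor = prime-divisor ∣ D ∣ 2≤∣D∣
  p = proj₁ divisor

  p∣D : + value p ∣ D
  p∣D = ∣ᵤ⇒∣ (proj₂ divisor)

  -- A common prime divisor of `D` and `E` would divide 1. Primes of `S` and prime divisors of `m`
  -- all divide `E`.
  p∤E : ¬ + value p ∣ E
  p∤E p∣E = p∤1 p (subst (+ value p ∣_)
    (solve 1 (λ e → (con 1ℤ :- e) :+ e := con 1ℤ) refl E) (∣m∣n⇒∣m+n p∣D p∣E))

  p∉S : p ∉ S
  p∉S p∈S = p∤E (∣n⇒∣m*n (+ 2 ℤ.* (+ 2 ℤ.* m ℤ.* N))
    (∣ᵤ⇒∣ (∈⇒∣product (∈-map⁺ value p∈S))))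

  p∤m : ¬ + value p ∣ m
  p∤m p∣m = p∤E (∣m⇒∣m*n N (∣n⇒∣m*n (+ 2) (∣m⇒∣m*n N (∣n⇒∣m*n (+ 2) p∣m))))

-- Integral points near two prescribed local points.

_≟ℙ_ : ∀ (p q : ℙ) → Dec (p ≡ q)
(p , _) ≟ℙ (q , _) with p ℕ.≟ q
... | yes refl = yes refl
... | no  p≢q  = no λ p≡q → p≢q (cong value p≡q)

module _ {A : ℙ → Set} where

  _[_≔_] : (∀ p → A p) → ∀ q → A q → ∀ p → A p
  (f [ q ≔ a ]) p with p ≟ℙ q
  ... | yes refl = a
  ... | no  _    = f p

  [≔]-same : ∀ f q (a : A q) → (f [ q ≔ a ]) q ≡ a
  [≔]-same f q a with q ≟ℙ q
  ... | yes refl = refl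
  ... | no  q≢q  = contradiction refl q≢q

  [≔]-other : ∀ f q (a : A q) {p} → p ≢ q → (f [ q ≔ a ]) p ≡ f p
  [≔]-other f q a {p} p≢q with p ≟ℙ q
  ... | yes p≡q = contradiction p≡q p≢q
  ... | no  _   = refl

mod^-trans : ∀ {p n} (a b c : ℤ[ p ]) → a ≡ b mod^ n → b ≡ c mod^ n → a ≡ c mod^ n
mod^-trans {n = n} a b c h k = subst (_ ∣_)
  (solve 3 (λ a b c → (a :- b) :+ (b :- c) := a :- c) refl
    (residue a n) (residue b n) (residue c n))
  (∣m∣n⇒∣m+n h k)
  where open ℤ.+-*-Solver

module _ {m : ℤ} (p : ℙ) (k : ℕ) where

  Ball-refl : ∀ (P : 𝒰 m (ℤₚ p)) → Ball p k P P
  Ball-refl (point x y z _) = ≈-refl {x} k , ≈-refl {y} k , ≈-refl {z} k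
    where open CommutativeRing (ℤₚ p) renaming (refl to ≈-refl)

  Ball-trans : ∀ {P Q R : 𝒰 m (ℤₚ p)} → Ball p k P Q → Ball p k Q R → Ball p k P R
  Ball-trans {point x y z _} {point x′ y′ z′ _} {point x″ y″ z″ _} (hx , hy , hz) (gx , gy , gz) =
    mod^-trans x x′ x″ hx gx , mod^-trans y y′ y″ hy gy , mod^-trans z z′ z″ hz gz

integral : ∀ p → 𝒰 m ℤ-ring → 𝒰 m (ℤ-adic p)
integral p = 𝒰-map ℤ-ring (ℤ-adic p) (ℤ→ℤ-adic-isRingHomomorphism p)

-- Density is applied to the families lying in both balls. Overwriting `local` at `p` and `q` shows
-- that this set is nonempty.
integer-point-near : ∀ {S} → HasDenseImage (diagonal S m) → (∀ p → 𝒰 m (ℤₚ p)) →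
  ∀ {p q} → p ∉ S → q ∉ S → p ≢ q → ∀ k (P : 𝒰 m (ℤₚ p)) (Q : 𝒰 m (ℤₚ q)) →
  ∃[ a ] Ball p k P (integral (value p) a) × Ball q k Q (integral (value q) a)
integer-point-near {m} {S} dense local {p} {q} p∉S q∉S p≢q k P Q =
  dense V V-open ((λ r _ → approximant r) , at-p , at-q)
  where
  V : ∏ₚ∉ S m → Set
  V R = Ball p k P (R p p∉S) × Ball q k Q (R q q∉S)

  V-open : IsOpen V
  -- By the ultrametric inequality a ball contains the ball of equal radius around each of its
  -- points, so the same `k` works.
  V-open R (hp , hq) = p ∷ q ∷ [] , k , λ R′ near →
      Ball-trans p k {P} {R p p∉S} {R′ p p∉S} hp (near p (here refl) p∉S)
    , Ball-trans q k {Q} {R q q∉S} {R′ q q∉S} hq (near q (there (here refl)) q∉S)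

  approximant : ∀ r → 𝒰 m (ℤₚ r)
  approximant = (local [ p ≔ P ]) [ q ≔ Q ]

  at-p : Ball p k P (approximant p)
  at-p = subst (Ball p k P)
    (sym (trans ([≔]-other (local [ p ≔ P ]) q Q p≢q) ([≔]-same local p P))) (Ball-refl p k P)

  at-q : Ball q k Q (approximant q)
  at-q = subst (Ball q k Q) (sym ([≔]-same (local [ p ≔ P ]) q Q)) (Ball-refl q k Q)

-- From congruences to vanishing coordinates.

n<p^n : ∀ {p} → 2 ℕ.≤ p → ∀ n → n ℕ.< p ℕ.^ n
n<p^n 2≤p zero    = s≤s z≤n
n<p^n {p} 2≤p (suc n) = begin-strict
  suc n               <⟨ ℕ.+-mono-≤-< (ℕ.≤-trans (s≤s z≤n) (n<p^n 2≤p n)) (n<p^n 2≤p n) ⟩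
  p ℕ.^ n ℕ.+ p ℕ.^ n ≡⟨ cong (p ℕ.^ n ℕ.+_) (ℕ.+-identityʳ _) ⟨
  2 ℕ.* p ℕ.^ n       ≤⟨ ℕ.*-monoˡ-≤ (p ℕ.^ n) 2≤p ⟩
  p ℕ.* p ℕ.^ n       ∎
  where open ℕ.≤-Reasoning

d∣0-i⇒d∣i : ∀ {d} i → d ∣ 0ℤ ℤ.- i → d ∣ i
d∣0-i⇒d∣i {d} i h = subst (d ∣_)
  (solve 1 (λ i → :- (con 0ℤ :- i) := i) refl i) (∣m⇒∣-m h)
  where open ℤ.+-*-Solver

∣⇒zeroOr≥ : ∀ {B d} i → B ℕ.≤ d → + d ∣ i → ZeroOr≥ B i
∣⇒zeroOr≥ i B≤d d∣i with i ℤ.≟ 0ℤ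
... | yes i≡0 = inj₁ i≡0
... | no  i≢0 = inj₂ (ℕ.≤-trans B≤d
  (ℕ.∣⇒≤ {{ℕ.≢-nonZero λ ∣i∣≡0 → i≢0 (ℤ.∣i∣≡0⇒i≡0 ∣i∣≡0)}} (∣⇒∣ᵤ d∣i)))

-- The invariant survives each move: in `yz - x` both terms have the factor `e`, in `zx - y` the
-- factor `d`, and in `xy - z` the product takes `d` from `y` and `e` from `x`.
divisible⇒0 : ∀ {B d e} → 6 ℕ.≤ B → ∣ m ∣ ℕ.< B → B ℕ.≤ d → B ℕ.≤ e →
  ∀ x y z → + d ∣ y → + d ∣ z → + e ∣ x → + e ∣ z → markoff x y z ≡ m →
  x ≡ 0ℤ × y ≡ 0ℤ × z ≡ 0ℤ
divisible⇒0 {B = B} {d} {e} 6≤B m<B B≤d B≤e x y z d∣y d∣z e∣x e∣z =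
  markoff-descent 6≤B m<B Inv
    (λ {x y z} (d∣y , d∣z , e∣x , e∣z) →
      ∣⇒zeroOr≥ x B≤e e∣x , ∣⇒zeroOr≥ y B≤d d∣y , ∣⇒zeroOr≥ z B≤d d∣z)
    (λ {x y z} (d∣y , d∣z , e∣x , e∣z) →
      d∣y , d∣z , ∣m∣n⇒∣m-n (∣n⇒∣m*n y e∣z) e∣x , e∣z)
    (λ {x y z} (d∣y , d∣z , e∣x , e∣z) →
      ∣m∣n⇒∣m-n (∣m⇒∣m*n x d∣z) d∣y , d∣z , e∣x , e∣z)
    (λ {x y z} (d∣y , d∣z , e∣x , e∣z) →
      d∣y , ∣m∣n⇒∣m-n (∣n⇒∣m*n x d∣y) d∣z , e∣x , ∣m∣n⇒∣m-n (∣m⇒∣m*n y e∣x) e∣z)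
    x y z (d∣y , d∣z , e∣x , e∣z)
  where
  Inv : ℤ → ℤ → ℤ → Set
  Inv x y z = (+ d ∣ y) × (+ d ∣ z) × (+ e ∣ x) × (+ e ∣ z)

markoff≡0 : x ≡ 0ℤ × y ≡ 0ℤ × z ≡ 0ℤ → markoff x y z ≡ 0ℤ
markoff≡0 (refl , refl , refl) = refl

-- The cases of nonzero and zero `m`.

record SplitPrimes (m : ℤ) (S : List ℙ) : Set where
  field
    p q    : ℙ
    p∉S    : p ∉ S
    q∉S    : q ∉ S
    p≢q    : p ≢ q
    q∤m    : ¬ + value q ∣ m
    root-p : LiftableRoot (value p) m
    root-q : LiftableRoot (value q) m

split-primes : ∀ m → m ≢ 0ℤ → ∀ S → SplitPrimes m S
split-primes m m≢0 S =
  let (p , p∉S , _ , root-p)     = split-prime m m≢0 S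
      -- Adding `p` to the excluded primes forces `q` to differ from `p`.
      (q , q∉p∷S , q∤m , root-q) = split-prime m m≢0 (p ∷ S)
  in record
    { p   = p   ; q   = q
    ; p∉S = p∉S ; q∉S = λ q∈S → q∉p∷S (there q∈S)
    ; p≢q = λ p≡q → q∉p∷S (here (sym p≡q))
    ; q∤m = q∤m ; root-p = root-p ; root-q = root-q
    }

≤value^ : ∀ (p : ℙ) k → k ℕ.≤ value p ℕ.^ k
≤value^ p k = ℕ.<⇒≤ (n<p^n (2≤value p) k)

-- The exponent k is a variable here and below, since a closed one would make
-- the typechecker unfold the Newton iterates.
near-axes⇒m≡0 : ∀ (p q : ℙ) (r : LiftableRoot (value p) m) (r′ : LiftableRoot (value q) m)
  k → 6 ℕ.+ ∣ m ∣ ℕ.≤ k → (a : 𝒰 m ℤ-ring) →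
  Ball p k ([√m,0,0] r) (integral (value p) a) → Ball q k ([0,√m,0] r′) (integral (value q) a) →
  m ≡ 0ℤ
near-axes⇒m≡0 {m} p q r r′ k 6+m≤k (point x y z eq) (_ , p∣y , p∣z) (q∣x , _ , q∣z) =
  trans (sym eq′) (markoff≡0 (divisible⇒0 (ℕ.m≤m+n 6 ∣ m ∣) (ℕ.m<n+m ∣ m ∣ {6} (s≤s z≤n))
    (ℕ.≤-trans 6+m≤k (≤value^ p k)) (ℕ.≤-trans 6+m≤k (≤value^ q k)) x y z
    (d∣0-i⇒d∣i y p∣y) (d∣0-i⇒d∣i z p∣z) (d∣0-i⇒d∣i x q∣x) (d∣0-i⇒d∣i z q∣z) eq′))
  where
  eq′ : markoff x y z ≡ m
  eq′ = trans eq (fromℤ-ℤ m)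

[0,0,0] [3,3,3] : 𝒰 0ℤ ℤ-ring
[0,0,0] = point 0ℤ 0ℤ 0ℤ refl
[3,3,3] = point (+ 3) (+ 3) (+ 3) refl

-- Near the origin `p^k` divides all coordinates and serves as both `d` and `e`. Descent gives
-- `x = 0`, and the ball at `q` then reads `q^k ∣ 3 - 0`.
near-0-and-3⇒∣3 : ∀ (p q : ℙ) k → 6 ℕ.≤ k → (a : 𝒰 0ℤ ℤ-ring) →
  Ball p k (integral (value p) [0,0,0]) (integral (value p) a) →
  Ball q k (integral (value q) [3,3,3]) (integral (value q) a) →
  + (value q ℕ.^ k) ∣ + 3
near-0-and-3⇒∣3 p q k 6≤k (point x y z eq) (p∣x , p∣y , p∣z) (q∣3-x , _) =
  subst (λ t → + (value q ℕ.^ k) ∣ + 3 ℤ.- t)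
    (proj₁ (divisible⇒0 ℕ.≤-refl (s≤s z≤n) 6≤p^k 6≤p^k x y z
      (d∣0-i⇒d∣i y p∣y) (d∣0-i⇒d∣i z p∣z) (d∣0-i⇒d∣i x p∣x) (d∣0-i⇒d∣i z p∣z) eq))
    q∣3-x
  where
  6≤p^k : 6 ℕ.≤ value p ℕ.^ k
  6≤p^k = ℕ.≤-trans 6≤k (≤value^ p k)

dense⇒m≡0 : ∀ {S} → SplitPrimes m S → (∀ p → 𝒰 m (ℤₚ p)) →
  ∀ k → 6 ℕ.+ ∣ m ∣ ℕ.≤ k → HasDenseImage (diagonal S m) → m ≡ 0ℤ
dense⇒m≡0 primes local k 6+m≤k dense =
  let (a , near-p , near-q) = integer-point-near dense local p∉S q∉S p≢q k
        ([√m,0,0] root-p) ([0,√m,0] root-q)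
  in near-axes⇒m≡0 p q root-p root-q k 6+m≤k a near-p near-q
  where open SplitPrimes primes

-- `split-primes` excludes 0, so the primes are taken for 3. This makes `q` prime to 3, against
-- `q^k ∣ 3` with `k` positive.
m≡0⇒not-dense : ∀ {S} → SplitPrimes (+ 3) S → (∀ p → 𝒰 0ℤ (ℤₚ p)) →
  ∀ k → 6 ℕ.≤ k → ¬ HasDenseImage (diagonal S 0ℤ)
m≡0⇒not-dense primes local k@(suc j) 6≤k dense =
  let (a , near-p , near-q) = integer-point-near dense local p∉S q∉S p≢q k
        (integral (value p) [0,0,0]) (integral (value q) [3,3,3])
  in q∤m (∣-trans (∣ᵤ⇒∣ (ℕ.m∣m*n (value q ℕ.^ j))) (near-0-and-3⇒∣3 p q k 6≤k a near-p near-q))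
  where open SplitPrimes primes

theorem6p2 : (m : ℤ) → 𝒰[𝔸ℤ] m → (S : List ℙ) → ¬ HasDenseImage (diagonal S m)
theorem6p2 m (_ , local) S dense = by-cases (m ℤ.≟ 0ℤ)
  where
  by-cases : Dec (m ≡ 0ℤ) → ⊥
  -- Since `k ≤ p^k`, this exponent makes both prime powers at least `B = 6 + |m|`, which is at
  -- least 6 and exceeds `|m|`.
  by-cases (no m≢0)   = m≢0 (dense⇒m≡0 (split-primes m m≢0 S) local (6 ℕ.+ ∣ m ∣) ℕ.≤-refl dense)
  by-cases (yes refl) = m≡0⇒not-dense (split-primes (+ 3) (λ ()) S) local 6 ℕ.≤-refl dense
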